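{- Let $q$ be a prime power and let $n\in\{2,3\}$. Then there are no non-trivial perfect linear flag-rank-metric codes in $\mathrm{U}(n,\mathbb{F}_q)$; that is, no linear flag-rank-metric code $\mathcal{C}\subsetneq \mathrm{U}(n,\mathbb{F}_q)$ is perfect.
   Context: $\mathbb{F}_q$ is the finite field with $q$ elements. $\mathrm{U}(n,\mathbb{F}_q)$ is the $\mathbb{F}_q$-vector space of $n\times n$ upper triangular matrices over $\mathbb{F}_q$. For $M\in \mathrm{U}(n,\mathbb{F}_q)$ and $1\le i\le n$, $M_{[i]}$ is the $i\times(n-i+1)$ submatrix of $M$ obtained by deleting the first $i-1$ columns and the last $n-i$ rows (i.e. rows $1,\dots,i$ and columns $i,\dots,n$). The flag-rank weight of $M$ is $\mathrm{fr}(M)=\sum_{i=1}^{n}\mathrm{rk}(M_{[i]})$; the flag-rank distance is $\mathrm{d}_{\mathrm{fr}}(A,B)=\mathrm{fr}(A-B)$. A linear flag-rank-metric code is an $\mathbb{F}_q$-subspace $\mathcal{C}$ of $\mathrm{U}(n,\mathbb{F}_q)$; its minimum (flag-rank) distance, defined when $\mathcal{C}\neq\{\boldsymbol{0}\}$, is $\delta=\min\{\mathrm{fr}(M):M\in\mathcal{C}\setminus\{\boldsymbol{0}\}\}$. Let $b_q(n,t)=|\{A\in \mathrm{U}(n,\mathbb{F}_q):\mathrm{fr}(A)\le t\}|$. A (nonzero) code $\mathcal{C}$ with minimum distance $\delta$ is perfect if $|\mathcal{C}|\,b_q(n,t)=q^{\frac{n(n+1)}{2}}$, where $t=\left\lfloor\frac{\delta-1}{2}\right\rfloor$.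 The code $\mathcal{C}=\mathrm{U}(n,\mathbb{F}_q)$ is the trivial perfect code. -}

module Defs where

open import Algebra.Apartness.Bundles using (HeytingField; HeytingCommutativeRing)
open import Algebra.Bundles using (CommutativeRing)
import Algebra.Definitions.RawMonoid as RawMonoidSum
import Algebra.Properties.Monoid.Sum as MonoidSum
open import Data.Fin.Base using (Fin; zero; suc; toℕ; inject!; cast; _↑ʳ_; finToFun; funToFin)
import Data.Fin.Base as Fin
open import Data.Fin.Properties using (toℕ<n; all?; finToFun-funToFin)
import Data.Fin.Properties as Fin
open import Data.Fin.Subset using (Subset; ∣_∣; _∉_) renaming (⊥ to ∅)
open import Data.Fin.Subset.Properties using (_∈?_; anySubset?; ∣p∣≤n; ∣⊥∣≡0; ∉⊥)
open import Data.Nat.Base using (ℕ; zero; suc; _∸_; _≤_; _^_)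
open import Data.Nat.DivMod using (_/_)
import Data.Nat.Base as ℕ
import Data.Nat.Properties as ℕ
open import Data.Nat.Primality using (Prime)
open import Data.Product.Base using (Σ; ∃; ∃₂; _×_; _,_; proj₁; proj₂)
open import Function.Base using (_∘_)
open import Function.Bundles using (Bijection)
open import Level using (Level; _⊔_) renaming (suc to lsuc)
open import Relation.Binary.Bundles using (Setoid)
import Relation.Binary.Construct.On as On
open import Relation.Binary.Definitions using (_Respects_)
open import Relation.Binary.PropositionalEquality.Core using (_≡_; refl)
import Relation.Binary.PropositionalEquality.Core as ≡
import Relation.Binary.PropositionalEquality.Properties as ≡
open import Relation.Nullary.Decidable using (Dec; yes; no; map′; ¬?; _×-dec_; _→-dec_)
open import Relation.Nullary.Negation using (¬_; contradiction)
open import Relation.Unary using (Pred; _⊆_)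

PrimePower : ℕ → Set
PrimePower q = ∃₂ λ p k → Prime p × q ≡ p ^ suc k

HasCardinality : ∀ {a ℓ} → Setoid a ℓ → ℕ → Set (a ⊔ ℓ)
HasCardinality S k = Bijection (≡.setoid (Fin k)) S

Subsetoid : ∀ {a ℓ p} (S : Setoid a ℓ) → Pred (Setoid.Carrier S) p → Setoid (a ⊔ p) ℓ
Subsetoid S P = On.setoid {B = Σ (Setoid.Carrier S) P} S proj₁

sumℕ : ∀ {n} → (Fin n → ℕ) → ℕ
sumℕ = RawMonoidSum.sum ℕ.+-0-rawMonoid

-- In a finite Heyting field equality is decidable, so apartness coincides with
-- inequality and every nonzero element is invertible.
record FiniteField (q : ℕ) (c ℓ₁ ℓ₂ : Level) : Set (lsuc (c ⊔ ℓ₁ ⊔ ℓ₂)) where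
  field
    heytingField : HeytingField c ℓ₁ ℓ₂

  commutativeRing : CommutativeRing c ℓ₁
  commutativeRing =
    HeytingCommutativeRing.commutativeRing (HeytingField.heytingCommutativeRing heytingField)

  field
    cardinality : HasCardinality (CommutativeRing.setoid commutativeRing) q

module FlagRank {q : ℕ} {c ℓ₁ ℓ₂ : Level} (F : FiniteField q c ℓ₁ ℓ₂) where

  open FiniteField F using (commutativeRing; cardinality)
  open CommutativeRing commutativeRing
    using (Carrier; _≈_; _+_; _*_; 0#; setoid; isEquivalence; +-monoid; +-rawMonoid; *-congʳ)
  private
    module K = CommutativeRing commutativeRing
    module Enum = Bijection cardinality

  open RawMonoidSum +-rawMonoid using (sum)

  Matrix : ℕ → ℕ → Set c
  Matrix k m = Fin k → Fin m → Carrier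

  infix 4 _≈ᴹ_
  infixl 6 _+ᴹ_
  infixr 7 _·ᴹ_

  _≈ᴹ_ : ∀ {k m} → Matrix k m → Matrix k m → Set ℓ₁
  A ≈ᴹ B = ∀ i j → A i j ≈ B i j

  0ᴹ : ∀ {k m} → Matrix k m
  0ᴹ i j = 0#

  _+ᴹ_ : ∀ {k m} → Matrix k m → Matrix k m → Matrix k m
  (A +ᴹ B) i j = A i j + B i j

  _·ᴹ_ : ∀ {k m} → Carrier → Matrix k m → Matrix k m
  (x ·ᴹ A) i j = x * A i j

  matrixSetoid : ℕ → ℕ → Setoid c ℓ₁
  matrixSetoid k m = record
    { Carrier       = Matrix k m
    ; _≈_           = _≈ᴹ_
    ; isEquivalence = record
      { refl  = λ i j → K.refl
      ; sym   = λ A≈B i j → K.sym (A≈B i j)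
      ; trans = λ A≈B B≈C i j → K.trans (A≈B i j) (B≈C i j)
      }
    }

  -- The rows of A with index in S are linearly independent: the coefficients x
  -- are those of a combination of these rows, extended by 0 outside S.
  IndependentRows : ∀ {k m} → Matrix k m → Pred (Subset k) (c ⊔ ℓ₁)
  IndependentRows {k} A S = ∀ (x : Fin k → Carrier) →
    (∀ i → i ∉ S → x i ≈ 0#) → (∀ j → sum (λ i → x i * A i j) ≈ 0#) → ∀ i → x i ≈ 0#

  HasRank : ∀ {k m} → Matrix k m → ℕ → Set (c ⊔ ℓ₁)
  HasRank A r = (∃ λ S → IndependentRows A S × ∣ S ∣ ≡ r)
              × (∀ S → IndependentRows A S → ∣ S ∣ ≤ r)

  private
    _≟_ : ∀ x y → Dec (x ≈ y)
    x ≟ y with Enum.strictlySurjective x | Enum.strictlySurjective y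
    ... | i , i↦x | j , j↦y = map′
      (λ { refl → K.trans (K.sym i↦x) j↦y })
      (λ x≈y → Enum.injective (K.trans i↦x (K.trans x≈y (K.sym j↦y))))
      (i Fin.≟ j)

    independentRows? : ∀ {k m} (A : Matrix k m) S → Dec (IndependentRows A S)
    independentRows? {k} A S = map′ to (λ ind y → ind (vec y)) (all? λ y →
        all? (λ i → ¬? (i ∈? S) →-dec (vec y i ≟ 0#)) →-dec
        (all? (λ j → sum (λ i → vec y i * A i j) ≟ 0#) →-dec
        all? (λ i → vec y i ≟ 0#)))
      where
      vec : Fin (q ^ k) → Fin k → Carrier
      vec y i = Enum.to (finToFun y i)

      index : (Fin k → Carrier) → Fin (q ^ k)
      index x = funToFin (proj₁ ∘ Enum.strictlySurjective ∘ x)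

      vec-index : ∀ x i → vec (index x) i ≈ x i
      vec-index x i = K.trans
        (K.reflexive (≡.cong Enum.to (finToFun-funToFin (proj₁ ∘ Enum.strictlySurjective ∘ x) i)))
        (proj₂ (Enum.strictlySurjective (x i)))

      to : (∀ y → (∀ i → i ∉ S → vec y i ≈ 0#) →
                  (∀ j → sum (λ i → vec y i * A i j) ≈ 0#) → ∀ i → vec y i ≈ 0#) →
           IndependentRows A S
      to ind x x∉S xA≈0 i = K.trans (K.sym (vec-index x i)) (ind (index x)
        (λ i i∉S → K.trans (vec-index x i) (x∉S i i∉S))
        (λ j → K.trans (MonoidSum.sum-cong-≋ +-monoid (λ i → *-congʳ (vec-index x i))) (xA≈0 j))
        i)

  rank-exists : ∀ {k m} (A : Matrix k m) → ∃ (HasRank A)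
  rank-exists {k} A = search k (λ S _ → ∣p∣≤n S)
    where
    search : ∀ b → (∀ S → IndependentRows A S → ∣ S ∣ ≤ b) → ∃ (HasRank A)
    search b bound with anySubset? (λ S → independentRows? A S ×-dec (∣ S ∣ ℕ.≟ b))
    search b       bound | yes attained = b , attained , bound
    search zero    bound | no ¬attained =
      contradiction (∅ , (λ x x∉∅ _ i → x∉∅ i ∉⊥) , ∣⊥∣≡0 k) ¬attained
    search (suc b) bound | no ¬attained = search b λ S ind →
      ℕ.≤-pred (ℕ.≤∧≢⇒< (bound S ind) (λ eq → ¬attained (S , ind , eq)))

  rank : ∀ {k m} → Matrix k m → ℕ
  rank A = proj₁ (rank-exists A)

  UpperTriangular : ∀ {n} → Pred (Matrix n n) ℓ₁
  UpperTriangular A = ∀ i j → j Fin.< i → A i j ≈ 0#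

  -- Indices start at 0: rows 0, …, i and columns i, …, n - 1.
  block : ∀ {n} → Matrix n n → (i : Fin n) → Matrix (suc (toℕ i)) (n ∸ toℕ i)
  block A i a b =
    A (inject! {i = suc i} a) (cast (ℕ.m+[n∸m]≡n (ℕ.<⇒≤ (toℕ<n i))) (toℕ i ↑ʳ b))

  fr : ∀ {n} → Matrix n n → ℕ
  fr A = sumℕ λ i → rank (block A i)

  record IsLinearCode {n ℓ} (C : Pred (Matrix n n) ℓ) : Set (c ⊔ ℓ₁ ⊔ ℓ) where
    field
      upperTriangular : C ⊆ UpperTriangular
      respects        : C Respects _≈ᴹ_
      0-closed        : C 0ᴹ
      +-closed        : ∀ {A B} → C A → C B → C (A +ᴹ B)
      ·-closed        : ∀ x {A} → C A → C (x ·ᴹ A)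

  -- No δ satisfies this when C is the zero code.
  HasMinimumDistance : ∀ {n ℓ} → Pred (Matrix n n) ℓ → ℕ → Set (c ⊔ ℓ₁ ⊔ ℓ)
  HasMinimumDistance C δ = (∃ λ A → C A × ¬ (A ≈ᴹ 0ᴹ) × fr A ≡ δ)
                         × (∀ A → C A → ¬ (A ≈ᴹ 0ᴹ) → δ ≤ fr A)

  Ball : ∀ n → ℕ → Pred (Matrix n n) ℓ₁
  Ball n t A = UpperTriangular A × fr A ≤ t

  -- The variables δ, s and b stand for the minimum distance, |C| and b_q(n, t).
  Perfect : ∀ {n ℓ} → Pred (Matrix n n) ℓ → Set (c ⊔ ℓ₁ ⊔ ℓ)
  Perfect {n} C = ∃ λ δ → ∃₂ λ s b →
      HasMinimumDistance C δ
    × HasCardinality (Subsetoid (matrixSetoid n n) C) s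
    × HasCardinality (Subsetoid (matrixSetoid n n) (Ball n ((δ ∸ 1) / 2))) b
    × s ℕ.* b ≡ q ^ ((n ℕ.* (n ℕ.+ 1)) / 2)

{-# OPTIONS --safe #-}

-- The balls of radius 0 and 1 are {0} and a set of diagonal matrices, and fr ≤ 4 for n ≤ 3, so
-- t ≤ 1. If t = 0 then |C| = |U(n, F)|, so C is trivial. If t = 1 then n = 3 and δ ≥ 3. A matrix in
-- U(3, F) whose last column is zero has flag-rank at most 2, so a codeword is determined by its last
-- column and |C| ≤ q³. The ball of radius 1 misses the identity matrix, so b < q³. Hence |C| b < q⁶.

module Submission where

open import Data.Nat.Base using (ℕ)
open import Data.Sum.Base using (_⊎_)
open import Level using (Level)
open import Relation.Binary.PropositionalEquality.Core using (_≡_)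
open import Relation.Nullary.Negation using (¬_)
open import Relation.Unary using (Pred; _⊂_)
open import Defs

open import Algebra.Apartness.Bundles using (HeytingField)
import Algebra.Apartness.Properties.HeytingCommutativeRing as HeytingProperties
open import Algebra.Bundles using (CommutativeRing)
import Algebra.Properties.Ring as RingProperties
import Algebra.Properties.Semiring.Sum as SemiringSum
open import Data.Fin.Base as Fin
  using (Fin; zero; suc; toℕ; fromℕ<; inject!; cast; _↑ʳ_; finToFun; funToFin)
import Data.Fin.Properties as Fin
open import Data.Fin.Subset using (Subset; ∣_∣; _∈_; ⁅_⁆)
open import Data.Fin.Subset.Properties
  using (nonempty?; Empty-unique; ∣⊥∣≡0; ∣p∣≤n; ∣⁅x⁆∣≡1; x∈⁅x⁆; x∈⁅y⁆⇒x≡y; p⊆q⇒∣p∣≤∣q∣)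
open import Data.List.Base using (List; length; lookup; filter; cartesianProduct; allFin)
import Data.List.Membership.Propositional as List
open import Data.List.Membership.Propositional.Properties
  using (∈-filter⁺; ∈-cartesianProduct⁺; ∈-allFin)
open import Data.List.Relation.Unary.Any using (index)
open import Data.List.Relation.Unary.Any.Properties using (lookup-index)
open import Data.Nat.Base as ℕ using (zero; suc; _∸_; _≤_; _<_; _^_; z≤n; s≤s)
open import Data.Nat.DivMod using (_/_; /-monoˡ-≤)
import Data.Nat.Properties as ℕ
open import Data.Product.Base using (∃₂; _×_; _,_; proj₁; proj₂; uncurry)
open import Data.Sum.Base using (inj₁; inj₂; [_,_]′)
open import Data.Vec.Functional using ([]; _∷_)
open import Function.Base using (_∘_; _$_)
open import Function.Bundles using (module Bijection)
open import Function.Definitions using (Injective)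
open import Relation.Binary.Bundles using (Setoid)
open import Relation.Binary.PropositionalEquality
  using (_≢_; refl; sym; trans; cong; cong₂; subst; module ≡-Reasoning)
import Relation.Binary.Reasoning.Setoid as SetoidReasoning
open import Relation.Nullary.Decidable using (yes; no; decidable-stable)
open import Relation.Nullary.Negation using (contradiction)
open import Relation.Unary using (_⊆_)

-- Counting by injections and bounds on finite sums

injective-misses⇒< : ∀ {m n} {f : Fin m → Fin n} → Injective _≡_ _≡_ f →
                     ∀ y → (∀ i → f i ≢ y) → m < n
-- Prepending the missed value `y` extends `f` to an injection out of `Fin (suc m)`.
injective-misses⇒< {f = f} f-inj y misses = Fin.injective⇒≤ extended-inj
  where
  extended-inj : Injective _≡_ _≡_ (y ∷ f)
  extended-inj {zero}  {zero}  _  = refl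
  extended-inj {zero}  {suc j} eq = contradiction (sym eq) (misses j)
  extended-inj {suc i} {zero}  eq = contradiction eq (misses i)
  extended-inj {suc i} {suc j} eq = cong suc (f-inj eq)

-- The map `f` may depend on the representative of a class: it is evaluated only at the
-- representatives chosen by the enumeration.
module _ {a ℓ p} {S : Setoid a ℓ} {P : Pred (Setoid.Carrier S) p} {k m}
         (card : HasCardinality (Subsetoid S P) k)
         (f : Setoid.Carrier S → Fin m)
         (f-inj : ∀ x y → P x → P y → f x ≡ f y → Setoid._≈_ S x y) where

  private
    module B = Bijection card

    enumerated-inj : Injective _≡_ _≡_ (f ∘ proj₁ ∘ B.to)
    enumerated-inj {i} {j} = B.injective ∘ f-inj _ _ (proj₂ (B.to i)) (proj₂ (B.to j))

  cardinality-≤ : k ≤ m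
  cardinality-≤ = Fin.injective⇒≤ enumerated-inj

  cardinality-< : ∀ y → (∀ i → f (proj₁ (B.to i)) ≢ y) → k < m
  cardinality-< = injective-misses⇒< enumerated-inj

term≤sumℕ : ∀ {n} (f : Fin n → ℕ) i → f i ≤ sumℕ f
term≤sumℕ f zero    = ℕ.m≤m+n _ _
term≤sumℕ f (suc i) = ℕ.≤-trans (term≤sumℕ (f ∘ suc) i) (ℕ.m≤n+m _ _)

two-terms≤sumℕ : ∀ {n} (f : Fin n → ℕ) {i j} → i Fin.< j → f i ℕ.+ f j ≤ sumℕ f
two-terms≤sumℕ f {zero}  {suc j} _         = ℕ.+-monoʳ-≤ (f zero) (term≤sumℕ (f ∘ suc) j)
two-terms≤sumℕ f {suc i} {suc j} (s≤s i<j) =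
  ℕ.≤-trans (two-terms≤sumℕ (f ∘ suc) i<j) (ℕ.m≤n+m _ _)

sumℕ-mono-≤ : ∀ {n} {f g : Fin n → ℕ} → (∀ i → f i ≤ g i) → sumℕ f ≤ sumℕ g
sumℕ-mono-≤ {zero}  f≤g = z≤n
sumℕ-mono-≤ {suc n} f≤g = ℕ.+-mono-≤ (f≤g zero) (sumℕ-mono-≤ (f≤g ∘ suc))

-- Being a concrete list, it has a length that evaluates to 3 for `n = 2` and 6 for `n = 3`, the
-- exponents in the definition of a perfect code.
upperPositions : ∀ n → List (Fin n × Fin n)
upperPositions n = filter (uncurry Fin._≤?_) (cartesianProduct (allFin n) (allFin n))

∈-upperPositions : ∀ {n} {i j : Fin n} → i Fin.≤ j → (i , j) List.∈ upperPositions n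
∈-upperPositions {i = i} {j} =
  ∈-filter⁺ (uncurry Fin._≤?_) (∈-cartesianProduct⁺ (∈-allFin i) (∈-allFin j))

-- Turns `δ ≤ 2` into `t ≤ 0` and `δ ≤ 4` into `t ≤ 1`.
radius-mono-≤ : ∀ {δ d} → δ ≤ d → (δ ∸ 1) / 2 ≤ (d ∸ 1) / 2
radius-mono-≤ δ≤d = /-monoˡ-≤ 2 (ℕ.∸-monoˡ-≤ 1 δ≤d)

toℕ-inject! : ∀ {n} {i : Fin (suc n)} (k : Fin.Fin′ i) → toℕ (inject! k) ≡ toℕ k
toℕ-inject! {n = suc _} {i = suc _} zero    = refl
toℕ-inject! {n = suc _} {i = suc _} (suc k) = cong suc (toℕ-inject! k)

module Codes {q : ℕ} {c ℓ₁ ℓ₂ : Level} (F : FiniteField q c ℓ₁ ℓ₂) where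

  open FlagRank F
  private
    module E = Bijection (FiniteField.cardinality F)
    module H = HeytingField (FiniteField.heytingField F)
  open CommutativeRing (FiniteField.commutativeRing F)
    using ( Carrier; _≈_; _+_; _*_; -_; 0#; 1#; setoid; ring; semiring; -‿cong
          ; +-cong; +-congˡ; +-congʳ; *-congˡ; *-congʳ; *-comm; *-assoc; *-identityˡ; *-identityʳ
          ; +-identityˡ; +-identityʳ; zeroˡ; zeroʳ; distribʳ; -‿inverseʳ )
    renaming (refl to ≈-refl; sym to ≈-sym; trans to ≈-trans; reflexive to ≈-reflexive)
  open H using (_#_; tight)
  open HeytingProperties H.heytingCommutativeRing using (1#0; x#0y#0→xy#0; #-congʳ)
  open RingProperties ring
    using (-1*x≈-x; -‿distribˡ-*; -‿involutive; -0#≈0#; x∙y⁻¹≈ε⇒x≈y; x≈y⇒x∙y⁻¹≈ε)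
  open SemiringSum semiring using (sum; sum-cong-≋; ∑-distrib-+; *-distribˡ-sum)

  -- Field facts and numbering of vectors

  1≉0 : ¬ 1# ≈ 0#
  1≉0 1≈0 = H.#-irrefl 1≈0 1#0

  -- Tightness of apartness; it allows equalities to be proved by contradiction.
  ¬#⇒≈ : ∀ {x y} → ¬ x # y → x ≈ y
  ¬#⇒≈ {x} {y} = proj₁ (tight x y)

  -x≈0⇒x≈0 : ∀ {x} → - x ≈ 0# → x ≈ 0#
  -x≈0⇒x≈0 {x} -x≈0 = ≈-trans (≈-sym (-‿involutive x)) (≈-trans (-‿cong -x≈0) -0#≈0#)

  -- Base-`q` numeral whose digits are the positions of the entries in the enumeration of the field.
  code : ∀ {m} → (Fin m → Carrier) → Fin (q ^ m)
  code x = funToFin (proj₁ ∘ E.strictlySurjective ∘ x)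

  code-injective : ∀ {m} (x y : Fin m → Carrier) → code x ≡ code y → ∀ i → x i ≈ y i
  code-injective x y eq i = ≈-trans (≈-sym (proj₂ (E.strictlySurjective (x i))))
    (≈-trans (≈-reflexive (cong E.to index-eq)) (proj₂ (E.strictlySurjective (y i))))
    where
    index-eq : proj₁ (E.strictlySurjective (x i)) ≡ proj₁ (E.strictlySurjective (y i))
    index-eq = trans (sym (Fin.finToFun-funToFin _ i))
      (trans (cong (λ k → finToFun k i) eq) (Fin.finToFun-funToFin _ i))

  -- Standard basis vectors and combinations of rows

  basis : ∀ {k} → Fin k → Fin k → Carrier
  basis zero    zero    = 1#
  basis zero    (suc l) = 0#
  basis (suc i) zero    = 0#
  basis (suc i) (suc l) = basis i l

  basis-diagonal : ∀ {k} (i : Fin k) → basis i i ≡ 1#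
  basis-diagonal zero    = refl
  basis-diagonal (suc i) = basis-diagonal i

  basis-offDiagonal : ∀ {k} (i l : Fin k) → i ≢ l → basis i l ≈ 0#
  basis-offDiagonal zero    zero    i≢l = contradiction refl i≢l
  basis-offDiagonal zero    (suc l) i≢l = ≈-refl
  basis-offDiagonal (suc i) zero    i≢l = ≈-refl
  basis-offDiagonal (suc i) (suc l) i≢l = basis-offDiagonal i l (i≢l ∘ cong suc)

  scaled-basis-offDiagonal : ∀ {k} (i l : Fin k) y → i ≢ l → y * basis i l ≈ 0#
  scaled-basis-offDiagonal i l y i≢l = ≈-trans (*-congˡ (basis-offDiagonal i l i≢l)) (zeroʳ y)

  sum-basis : ∀ {k} (i : Fin k) (v : Fin k → Carrier) → sum (λ l → basis i l * v l) ≈ v i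
  sum-basis zero    v = ≈-trans
    (+-cong (*-identityˡ _) (≈-trans (≈-sym (*-distribˡ-sum 0# (v ∘ suc))) (zeroˡ _)))
    (+-identityʳ _)
  sum-basis (suc i) v = ≈-trans (+-cong (zeroˡ _) (sum-basis i (v ∘ suc))) (+-identityˡ _)

  sum-two-rows : ∀ {k} (i l : Fin k) y z (v : Fin k → Carrier) →
    sum (λ r → (y * basis i r + z * basis l r) * v r) ≈ y * v i + z * v l
  sum-two-rows {k} i l y z v = begin
    sum (λ r → (y * basis i r + z * basis l r) * v r)
      ≈⟨ sum-cong-≋ {k} (λ r → ≈-trans (distribʳ _ _ _) (+-cong (*-assoc _ _ _) (*-assoc _ _ _))) ⟩
    sum (λ r → y * (basis i r * v r) + z * (basis l r * v r))
      ≈⟨ ∑-distrib-+ (λ r → y * (basis i r * v r)) (λ r → z * (basis l r * v r)) ⟩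
    sum (λ r → y * (basis i r * v r)) + sum (λ r → z * (basis l r * v r))
      ≈⟨ +-cong (scaled i y) (scaled l z) ⟩
    y * v i + z * v l ∎
    where
    open SetoidReasoning setoid
    scaled : ∀ i y → sum (λ r → y * (basis i r * v r)) ≈ y * v i
    scaled i y = ≈-trans (≈-sym (*-distribˡ-sum y (λ r → basis i r * v r)))
      (*-congˡ (sum-basis i v))

  module _ {k m} {A : Matrix k m} {S : Subset k} (ind : IndependentRows A S) where

    independent⇒nonzeroRow : ∀ {i} → i ∈ S → ¬ (∀ j → A i j ≈ 0#)
    independent⇒nonzeroRow {i} i∈S row≈0 = 1≉0 $ ≈-trans (≈-reflexive (sym (basis-diagonal i)))
      (ind (basis i)
        (λ l l∉S → basis-offDiagonal i l λ { refl → l∉S i∈S })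
        (λ j → ≈-trans (sum-basis i (λ r → A r j)) (row≈0 j))
        i)

    -- The vector with `y` at `i` and `z` at `l` is a relation supported in `S`; independence is
    -- read off at `l`.
    independent⇒¬proportional : ∀ {i l} → i ∈ S → l ∈ S → i ≢ l →
      ∀ y z → (∀ j → y * A i j + z * A l j ≈ 0#) → z ≈ 0#
    independent⇒¬proportional {i} {l} i∈S l∈S i≢l y z dependent = begin
      z                              ≈⟨ *-identityʳ z ⟨
      z * 1#                         ≡⟨ cong (z *_) (basis-diagonal l) ⟨
      z * basis l l                  ≈⟨ +-identityˡ _ ⟨
      0# + z * basis l l             ≈⟨ +-congʳ (scaled-basis-offDiagonal i l y i≢l) ⟨
      y * basis i l + z * basis l l  ≈⟨ ind (λ r → y * basis i r + z * basis l r) outside relation l ⟩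
      0#                             ∎
      where
      open SetoidReasoning setoid
      relation : ∀ j → sum (λ r → (y * basis i r + z * basis l r) * A r j) ≈ 0#
      relation j = ≈-trans (sum-two-rows i l y z (λ r → A r j)) (dependent j)

      outside : ∀ r → ¬ r ∈ S → y * basis i r + z * basis l r ≈ 0#
      outside r r∉S = ≈-trans
        (+-cong (scaled-basis-offDiagonal i r y λ { refl → r∉S i∈S })
                (scaled-basis-offDiagonal l r z λ { refl → r∉S l∈S }))
        (+-identityˡ 0#)

  -- Conversion checking would otherwise evaluate the exhaustive search inside rank.
  abstract
    rk : ∀ {k m} → Matrix k m → ℕ
    rk = rank

    rk-hasRank : ∀ {k m} (A : Matrix k m) → HasRank A (rk A)
    rk-hasRank A = proj₂ (rank-exists A)

    fr-blocks : ∀ {n} (A : Matrix n n) → fr A ≡ sumℕ λ i → rk (block A i)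
    fr-blocks A = refl

  -- Bounds on the rank

  rk-≤ : ∀ {k m r} (A : Matrix k m) → (∀ S → IndependentRows A S → ∣ S ∣ ≤ r) → rk A ≤ r
  rk-≤ {r = r} A bound =
    let (S , ind , ∣S∣≡rk) = proj₁ (rk-hasRank A)
    in subst (_≤ r) ∣S∣≡rk (bound S ind)

  rk≤rows : ∀ {k m} (A : Matrix k m) → rk A ≤ k
  rk≤rows A = rk-≤ A λ S _ → ∣p∣≤n S

  zero⇒rk≤0 : ∀ {k m} (A : Matrix k m) → A ≈ᴹ 0ᴹ → rk A ≤ 0
  zero⇒rk≤0 {k} A A≈0 = rk-≤ A λ S ind → ℕ.≤-reflexive $ trans
    (cong ∣_∣ (Empty-unique {p = S} λ { (i , i∈S) → independent⇒nonzeroRow ind i∈S (A≈0 i) }))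
    (∣⊥∣≡0 k)

  -- Any two rows supported in column `j` are proportional, so an independent set has at most one
  -- element.
  oneColumn⇒rk≤1 : ∀ {k m} (A : Matrix k m) j → (∀ i l → l ≢ j → A i l ≈ 0#) → rk A ≤ 1
  oneColumn⇒rk≤1 {k} A j others≈0 = rk-≤ A bound
    where
    bound : ∀ S → IndependentRows A S → ∣ S ∣ ≤ 1
    bound S ind with nonempty? S
    ... | no  empty     = subst (_≤ 1) (sym (trans (cong ∣_∣ (Empty-unique empty)) (∣⊥∣≡0 k))) z≤n
    ... | yes (i , i∈S) = subst (∣ S ∣ ≤_) (∣⁅x⁆∣≡1 i) (p⊆q⇒∣p∣≤∣q∣ λ {l} l∈S →
      subst (_∈ ⁅ i ⁆) (decidable-stable (i Fin.≟ l) (distinct l∈S)) (x∈⁅x⁆ i))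
      where
      distinct : ∀ {l} → l ∈ S → ¬ i ≢ l
      distinct {l} l∈S i≢l = independent⇒nonzeroRow ind i∈S row≈0
        where
        -- Cross-multiplication makes column `j` cancel; every other column vanishes already.
        dependent : ∀ r → A l j * A i r + - A i j * A l r ≈ 0#
        dependent r with r Fin.≟ j
        ... | yes refl = ≈-trans
          (+-cong (*-comm (A l j) (A i j)) (≈-sym (-‿distribˡ-* (A i j) (A l j)))) (-‿inverseʳ _)
        ... | no r≢j = ≈-trans
          (+-cong (≈-trans (*-congˡ (others≈0 i r r≢j)) (zeroʳ _))
                  (≈-trans (*-congˡ (others≈0 l r r≢j)) (zeroʳ _)))
          (+-identityˡ 0#)

        row≈0 : ∀ r → A i r ≈ 0#
        row≈0 r with r Fin.≟ j
        ... | yes refl = -x≈0⇒x≈0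
          (independent⇒¬proportional ind i∈S l∈S i≢l (A l j) (- A i j) dependent)
        ... | no r≢j   = others≈0 i r r≢j

  -- The single row `i` is independent: a product of elements apart from zero is apart from zero.
  #0⇒1≤rk : ∀ {k m} {A : Matrix k m} {i j} → A i j # 0# → 1 ≤ rk A
  #0⇒1≤rk {k} {A = A} {i} {j} Aij#0 =
    subst (_≤ rk A) (∣⁅x⁆∣≡1 i) (proj₂ (rk-hasRank A) ⁅ i ⁆ ind)
    where
    ind : IndependentRows A ⁅ i ⁆
    ind x x≈0-off xA≈0 l with l Fin.≟ i
    ... | no l≢i   = x≈0-off l (l≢i ∘ x∈⁅y⁆⇒x≡y i)
    ... | yes refl = ¬#⇒≈ λ xi#0 → H.#-irrefl xi*Aij≈0 (x#0y#0→xy#0 xi#0 Aij#0)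
      where
      open SetoidReasoning setoid
      -- Since `x` vanishes off `i`, the factor `basis i r` changes no term, and `sum-basis`
      -- collapses the sum to one term.
      supported : ∀ r → basis i r * (x r * A r j) ≈ x r * A r j
      supported r with i Fin.≟ r
      ... | yes refl = ≈-trans (*-congʳ (≈-reflexive (basis-diagonal i))) (*-identityˡ _)
      ... | no i≢r = ≈-trans (≈-trans (*-congʳ (basis-offDiagonal i r i≢r)) (zeroˡ _))
        (≈-sym (≈-trans (*-congʳ (x≈0-off r (i≢r ∘ sym ∘ x∈⁅y⁆⇒x≡y i))) (zeroˡ _)))

      xi*Aij≈0 : x i * A i j ≈ 0#
      xi*Aij≈0 = begin
        x i * A i j                           ≈⟨ sum-basis i (λ r → x r * A r j) ⟨
        sum (λ r → basis i r * (x r * A r j)) ≈⟨ sum-cong-≋ {k} supported ⟩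
        sum (λ r → x r * A r j)               ≈⟨ xA≈0 j ⟩
        0#                                    ∎

  -- Entries of blocks and lower bounds on the flag-rank

  -- Block `l` keeps the rows up to `l` and the columns from `l` on, so the entry sits in its row
  -- `i` and column `j ∸ l`.
  block-entry : ∀ {n} (A : Matrix n n) {i l j : Fin n} → i Fin.≤ l → l Fin.≤ j →
                ∃₂ λ a b → block A l a b ≡ A i j
  block-entry {n} A {i} {l} {j} i≤l l≤j = a , b , cong₂ A
    (Fin.toℕ-injective (trans (toℕ-inject! a) (Fin.toℕ-fromℕ< (s≤s i≤l))))
    (Fin.toℕ-injective (begin
      toℕ (cast _ (toℕ l ↑ʳ b))  ≡⟨ Fin.toℕ-cast _ (toℕ l ↑ʳ b) ⟩
      toℕ (toℕ l ↑ʳ b)           ≡⟨ Fin.toℕ-↑ʳ (toℕ l) b ⟩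
      toℕ l ℕ.+ toℕ b            ≡⟨ cong (toℕ l ℕ.+_) (Fin.toℕ-fromℕ< j∸l<n∸l) ⟩
      toℕ l ℕ.+ (toℕ j ∸ toℕ l)  ≡⟨ ℕ.m+[n∸m]≡n l≤j ⟩
      toℕ j                      ∎))
    where
    open ≡-Reasoning
    j∸l<n∸l : toℕ j ∸ toℕ l < n ∸ toℕ l
    j∸l<n∸l = ℕ.∸-monoˡ-< (Fin.toℕ<n j) l≤j
    a : Fin (suc (toℕ l))
    a = fromℕ< (s≤s i≤l)
    b : Fin (n ∸ toℕ l)
    b = fromℕ< j∸l<n∸l

  #0⇒1≤rk-block : ∀ {n} (A : Matrix n n) {i} l {j} → i Fin.≤ l → l Fin.≤ j →
                    A i j # 0# → 1 ≤ rk (block A l)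
  #0⇒1≤rk-block A l i≤l l≤j Aij#0 =
    let (_ , _ , entry≡) = block-entry A i≤l l≤j
    in #0⇒1≤rk {A = block A l} (subst (_# 0#) (sym entry≡) Aij#0)

  rk-block≤fr : ∀ {n} (A : Matrix n n) i → rk (block A i) ≤ fr A
  rk-block≤fr A i = subst (rk (block A i) ≤_) (sym (fr-blocks A))
    (term≤sumℕ (λ l → rk (block A l)) i)

  fr≤0⇒upper≈0 : ∀ {n} (A : Matrix n n) → fr A ≤ 0 → ∀ {i j} → i Fin.≤ j → A i j ≈ 0#
  fr≤0⇒upper≈0 A fr≤0 {i} {j} i≤j = ¬#⇒≈ λ Aij#0 → ℕ.<⇒≱
    (ℕ.≤-trans (#0⇒1≤rk-block A i ℕ.≤-refl i≤j Aij#0) (rk-block≤fr A i)) fr≤0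

  nonzero-blocks⇒2≤fr : ∀ {n} (A : Matrix n n) i j → i Fin.< j →
                        1 ≤ rk (block A i) → 1 ≤ rk (block A j) → 2 ≤ fr A
  nonzero-blocks⇒2≤fr A i j i<j 1≤rkᵢ 1≤rkⱼ = subst (2 ≤_) (sym (fr-blocks A))
    (ℕ.≤-trans (ℕ.+-mono-≤ 1≤rkᵢ 1≤rkⱼ) (two-terms≤sumℕ (λ l → rk (block A l)) i<j))

  -- An entry strictly above the diagonal lies in both block `i` and block `j`; if nonzero, it
  -- counts at least twice.
  fr≤1⇒strictlyUpper≈0 : ∀ {n} (A : Matrix n n) → fr A ≤ 1 → ∀ {i j} → i Fin.< j → A i j ≈ 0#
  fr≤1⇒strictlyUpper≈0 A fr≤1 {i} {j} i<j = ¬#⇒≈ λ Aij#0 → ℕ.<⇒≱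
    (nonzero-blocks⇒2≤fr A i j i<j (#0⇒1≤rk-block A i ℕ.≤-refl (ℕ.<⇒≤ i<j) Aij#0)
                                     (#0⇒1≤rk-block A j (ℕ.<⇒≤ i<j) ℕ.≤-refl Aij#0))
    fr≤1

  upperTriangular-≈ : ∀ {n} {A B : Matrix n n} → UpperTriangular A → UpperTriangular B →
                      (∀ {i j} → i Fin.≤ j → A i j ≈ B i j) → A ≈ᴹ B
  upperTriangular-≈ upperA upperB upper≈ i j with i Fin.≤? j
  ... | yes i≤j = upper≈ i≤j
  ... | no  i≰j = ≈-trans (upperA i j (ℕ.≰⇒> i≰j)) (≈-sym (upperB i j (ℕ.≰⇒> i≰j)))

  -- Balls of radius 0 and 1

  ball₀-cardinality : ∀ {n t b} → t ≤ 0 →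
    HasCardinality (Subsetoid (matrixSetoid n n) (Ball n t)) b → b ≤ 1
  -- The constant map into `Fin 1` is injective on the ball, whose only matrix is zero.
  ball₀-cardinality t≤0 card = cardinality-≤ card (λ _ → zero)
    λ { A B (upperA , frA≤t) (upperB , frB≤t) _ → upperTriangular-≈ upperA upperB λ i≤j →
      ≈-trans (fr≤0⇒upper≈0 A (ℕ.≤-trans frA≤t t≤0) i≤j)
              (≈-sym (fr≤0⇒upper≈0 B (ℕ.≤-trans frB≤t t≤0) i≤j)) }

  -- Matrices in the ball are determined by their diagonals. The all-ones diagonal is missed: it
  -- makes the blocks at `i` and `j` both nonzero.
  ball₁-cardinality : ∀ {n t b} (i j : Fin n) → i Fin.< j → t ≤ 1 →
    HasCardinality (Subsetoid (matrixSetoid n n) (Ball n t)) b → b < q ^ n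
  ball₁-cardinality {n} {t} i₀ j₀ i₀<j₀ t≤1 card =
    cardinality-< card (λ A → code (λ i → A i i)) diagonal-injective (code {n} λ _ → 1#) λ i →
      misses-identity (proj₁ (Bijection.to card i)) (proj₂ (Bijection.to card i))
    where
    diagonal-injective : ∀ A B → Ball n t A → Ball n t B →
      code (λ i → A i i) ≡ code (λ i → B i i) → A ≈ᴹ B
    diagonal-injective A B (upperA , frA≤t) (upperB , frB≤t) eq =
      upperTriangular-≈ upperA upperB λ {i} {j} i≤j →
        [ (λ i<j → ≈-trans (fr≤1⇒strictlyUpper≈0 A (ℕ.≤-trans frA≤t t≤1) i<j)
                           (≈-sym (fr≤1⇒strictlyUpper≈0 B (ℕ.≤-trans frB≤t t≤1) i<j)))
        , (λ i≡j → subst (λ l → A i l ≈ B i l) (Fin.toℕ-injective i≡j)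
                     (code-injective (λ l → A l l) (λ l → B l l) eq i))
        ]′ (ℕ.m≤n⇒m<n∨m≡n i≤j)

    misses-identity : ∀ A → Ball n t A → code (λ i → A i i) ≢ code {n} (λ _ → 1#)
    misses-identity A (_ , fr≤t) eq = ℕ.<⇒≱
      (nonzero-blocks⇒2≤fr A i₀ j₀ i₀<j₀ (1≤rk i₀) (1≤rk j₀))
      (ℕ.≤-trans fr≤t t≤1)
      where
      1≤rk : ∀ i → 1 ≤ rk (block A i)
      1≤rk i = #0⇒1≤rk-block A i ℕ.≤-refl ℕ.≤-refl
        (#-congʳ (≈-sym (code-injective (λ l → A l l) (λ _ → 1#) eq i)) 1#0)

  -- Upper bounds on the flag-rank for sizes 2 and 3

  fr-≤ : ∀ {n} (A : Matrix n n) (r : Fin n → ℕ) → (∀ i → rk (block A i) ≤ r i) → fr A ≤ sumℕ r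
  fr-≤ A r bound = subst (_≤ sumℕ r) (sym (fr-blocks A)) (sumℕ-mono-≤ bound)

  rk-block≤rows : ∀ {n} (A : Matrix n n) i → rk (block A i) ≤ suc (toℕ i)
  rk-block≤rows A i = rk≤rows (block A i)

  rk-block≤1 : ∀ {n} (A : Matrix n n) i j → (∀ a l → l ≢ j → block A i a l ≈ 0#) →
               rk (block A i) ≤ 1
  rk-block≤1 A i = oneColumn⇒rk≤1 (block A i)

  rk-block≤0 : ∀ {n} (A : Matrix n n) i → block A i ≈ᴹ 0ᴹ → rk (block A i) ≤ 0
  rk-block≤0 A i = zero⇒rk≤0 (block A i)

  fr₂≤2 : (A : Matrix 2 2) → fr A ≤ 2
  fr₂≤2 A = fr-≤ A (λ _ → 1) λ
    { zero       → rk-block≤rows A zero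
    ; (suc zero) → rk-block≤1 A (suc zero) zero λ { _ zero l≢0 → contradiction refl l≢0 }
    }

  fr₃≤4 : (A : Matrix 3 3) → fr A ≤ 4
  -- The blocks have sizes 1×3, 2×2 and 3×1.
  fr₃≤4 A = fr-≤ A (1 ∷ 2 ∷ 1 ∷ []) λ
    { zero             → rk-block≤rows A zero
    ; (suc zero)       → rk-block≤rows A (suc zero)
    ; (suc (suc zero)) →
        rk-block≤1 A (suc (suc zero)) zero λ { _ zero l≢0 → contradiction refl l≢0 }
    }

  lastColumn≈0⇒fr₃≤2 : (A : Matrix 3 3) → (∀ i → A i (suc (suc zero)) ≈ 0#) → fr A ≤ 2
  -- The middle block keeps one possibly nonzero column, and the last block is the zero column
  -- itself.
  lastColumn≈0⇒fr₃≤2 A last≈0 = fr-≤ A (1 ∷ 1 ∷ 0 ∷ []) λ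
    { zero             → rk-block≤rows A zero
    ; (suc zero)       → rk-block≤1 A (suc zero) zero λ
        { _ zero l≢0       → contradiction refl l≢0
        ; _ (suc zero) l≢0 → last≈0 _
        }
    ; (suc (suc zero)) → rk-block≤0 A (suc (suc zero)) λ { _ zero → last≈0 _ }
    }

  -- Cardinality of linear codes

  upperCode : ∀ {n} → Matrix n n → Fin (q ^ length (upperPositions n))
  upperCode {n} A = code (uncurry A ∘ lookup (upperPositions n))

  upperCode-injective : ∀ {n} {A B : Matrix n n} → UpperTriangular A → UpperTriangular B →
                        upperCode A ≡ upperCode B → A ≈ᴹ B
  upperCode-injective {n} {A} {B} upperA upperB eq = upperTriangular-≈ upperA upperB λ i≤j →
    let ij∈ = ∈-upperPositions i≤j
    in subst (λ p → uncurry A p ≈ uncurry B p) (sym (lookup-index ij∈))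
         (code-injective (uncurry A ∘ lookup (upperPositions n))
                         (uncurry B ∘ lookup (upperPositions n)) eq (index ij∈))

  -- The case `t = 0`. If the number of `A` is attained by a codeword, that codeword equals `A`; if
  -- it is missed, `s` falls strictly below the required product.
  large⇒full : ∀ {n ℓ s b} {C : Pred (Matrix n n) ℓ} → IsLinearCode C →
    HasCardinality (Subsetoid (matrixSetoid n n) C) s → b ≤ 1 →
    s ℕ.* b ≡ q ^ length (upperPositions n) → UpperTriangular ⊆ C
  large⇒full {n} {s = s} {b} {C} linear card b≤1 sb≡ {A} upperA
    with Fin.any? (λ i → upperCode (proj₁ (Bijection.to card i)) Fin.≟ upperCode A)
  ... | yes (i , eq) =
    let (B , CB) = Bijection.to card i
    in respects (upperCode-injective (upperTriangular CB) upperA eq) CB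
    where open IsLinearCode linear
  ... | no  missed   = contradiction sb≡ (ℕ.<⇒≢ (ℕ.≤-<-trans sb≤s s<∣U∣))
    where
    open IsLinearCode linear
    sb≤s : s ℕ.* b ≤ s
    sb≤s = ℕ.≤-trans (ℕ.*-monoʳ-≤ s b≤1) (ℕ.≤-reflexive (ℕ.*-identityʳ s))

    s<∣U∣ : s < q ^ length (upperPositions n)
    s<∣U∣ = cardinality-< card upperCode
      (λ _ _ CB CB′ → upperCode-injective (upperTriangular CB) (upperTriangular CB′))
      (upperCode A) (λ i eq → missed (i , eq))

  -- A Singleton-type argument: codewords sharing a last column differ by a codeword of flag-rank at
  -- most 2, which must be zero.
  lastColumn-bound : ∀ {ℓ s} {C : Pred (Matrix 3 3) ℓ} → IsLinearCode C →
    (∀ A → C A → ¬ A ≈ᴹ 0ᴹ → 3 ≤ fr A) →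
    HasCardinality (Subsetoid (matrixSetoid 3 3) C) s → s ≤ q ^ 3
  lastColumn-bound {C = C} linear 3≤fr card =
    cardinality-≤ card (code ∘ lastColumn) lastColumn-injective
    where
    open IsLinearCode linear

    lastColumn : Matrix 3 3 → Fin 3 → Carrier
    lastColumn A i = A i (suc (suc zero))

    difference : Matrix 3 3 → Matrix 3 3 → Matrix 3 3
    -- Written with the scalar `- 1#` so that closure under sums and scalar multiples applies
    -- directly.
    difference A B = A +ᴹ (- 1#) ·ᴹ B

    x-y : ∀ x y → x + - 1# * y ≈ x + - y
    x-y x y = +-congˡ (-1*x≈-x y)

    lastColumn-injective : ∀ A B → C A → C B →
      code (lastColumn A) ≡ code (lastColumn B) → A ≈ᴹ B
    lastColumn-injective A B CA CB eq i j = ¬#⇒≈ λ Aij#Bij → ℕ.<⇒≱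
      (3≤fr (difference A B) (+-closed CA (·-closed (- 1#) CB)) λ D≈0 → H.#-irrefl
        (x∙y⁻¹≈ε⇒x≈y (A i j) (B i j) (≈-trans (≈-sym (x-y (A i j) (B i j))) (D≈0 i j))) Aij#Bij)
      (lastColumn≈0⇒fr₃≤2 (difference A B) λ l → ≈-trans (x-y _ _)
        (x≈y⇒x∙y⁻¹≈ε (code-injective (lastColumn A) (lastColumn B) eq l)))

-- The cases of size 2 and size 3

corollary5p2 : ∀ {c ℓ₁ ℓ₂ ℓ : Level} {q n : ℕ} → PrimePower q → n ≡ 2 ⊎ n ≡ 3 →
    (F : FiniteField q c ℓ₁ ℓ₂) → let open FlagRank F in
    (C : Pred (Matrix n n) ℓ) → IsLinearCode C → C ⊂ UpperTriangular → ¬ Perfect C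
corollary5p2 _ (inj₁ refl) F C linear (_ , U⊈C)
  (δ , s , b , ((A , _ , _ , frA≡δ) , _) , |C|≡s , |ball|≡b , sb≡q³) =
  U⊈C (large⇒full linear |C|≡s (ball₀-cardinality (radius-mono-≤ δ≤2) |ball|≡b) sb≡q³)
  where
  open Codes F
  -- A codeword of minimum weight already obeys the bound on all matrices, so the radius is 0.
  δ≤2 : δ ≤ 2
  δ≤2 = subst (_≤ 2) frA≡δ (fr₂≤2 A)
corollary5p2 {q = q} _ (inj₂ refl) F C linear (_ , U⊈C)
  (δ , s , b , ((A , _ , _ , frA≡δ) , minimal) , |C|≡s , |ball|≡b , sb≡q⁶) =
  -- For `δ ≤ 2` the radius is 0 and the code is full; for `3 ≤ δ` the product `s ℕ.* b` is too
  -- small.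
  [ (λ δ≤2 → U⊈C (large⇒full linear |C|≡s (ball₀-cardinality (radius-mono-≤ δ≤2) |ball|≡b) sb≡q⁶))
  , (λ 3≤δ → ℕ.<⇒≢ (sb<q⁶ 3≤δ) sb≡q⁶)
  ]′ (ℕ.≤-<-connex δ 2)
  where
  open Codes F
  δ≤4 : δ ≤ 4
  δ≤4 = subst (_≤ 4) frA≡δ (fr₃≤4 A)

  b<q³ : b < q ^ 3
  b<q³ = ball₁-cardinality zero (suc zero) (s≤s z≤n) (radius-mono-≤ δ≤4) |ball|≡b

  -- Strict monotonicity of multiplication by `q ^ 3` requires a nonzero factor; `b < q ^ 3`
  -- supplies it.
  instance
    q³≢0 : ℕ.NonZero (q ^ 3)
    q³≢0 = ℕ.>-nonZero (ℕ.≤-<-trans z≤n b<q³)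

  sb<q⁶ : 3 ≤ δ → s ℕ.* b < q ^ 6
  sb<q⁶ 3≤δ = begin-strict
    s ℕ.* b          ≤⟨ ℕ.*-monoˡ-≤ b (lastColumn-bound linear 3≤fr |C|≡s) ⟩
    q ^ 3 ℕ.* b      <⟨ ℕ.*-monoʳ-< (q ^ 3) b<q³ ⟩
    q ^ 3 ℕ.* q ^ 3  ≡⟨ ℕ.^-distribˡ-+-* q 3 3 ⟨
    q ^ 6            ∎
    where
    open ℕ.≤-Reasoning
    3≤fr : ∀ B → C B → ¬ FlagRank._≈ᴹ_ F B (FlagRank.0ᴹ F) → 3 ≤ FlagRank.fr F B
    3≤fr B CB B≉0 = ℕ.≤-trans 3≤δ (minimal B CB B≉0)
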